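{- Let $\mathbf{a}$ be a weak composition of length $n$. Consider the graph with vertex set $\mathrm{LKT}(\mathbf{a})$ and an edge between $T$ and $e_i(T)$ whenever $1\le i<n$ and $e_i(T)\neq 0$, where $e_i$ is the lock raising operator. Then this graph is connected.
   Context: A weak composition is a finite sequence $\mathbf{a}=(a_1,\ldots,a_n)$ of nonnegative integers. A diagram is a finite set of cells $(c,r)$ with $c,r$ positive integers ($c$ column, $r$ row, rows numbered from the bottom). A labeled diagram assigns a positive integer label to each cell; $\mathbb{D}(T)$ denotes its underlying (unlabeled) diagram. Let $M=\max_i a_i$. A lock Kohnert tableau of content $\mathbf{a}$ is a labeled diagram with labels $1^{a_1},\ldots,n^{a_n}$ (one per cell) such that: (1) for each $i$ there is exactly one cell labeled $i$ in each of the columns $M-a_i+1,\ldots,M$; (2) every label in row $r$ is at least $r$; (3) the cells labeled $i$ weakly descend (in row index) from left to right; (4) labels strictly decrease going down each column. $\mathrm{LKT}(\mathbf{a})$ is the set of these; each diagram has at most one labeling making it a lock Kohnert tableau of content $\mathbf{a}$. Raising operators on diagrams: for a diagram $D$ and $i\ge1$, the vertical $i$-pairing pairs any cells in rows $i$ and $i+1$ lying in the same column, and then iteratively pairs any unpaired cell of row $i+1$ with the rightmost unpaired cell of row $i$ in a column to its left, whenever all cells of rows $i,i+1$ in the columns strictly between them are already paired. $e_i(D)$ is obtained by moving the rightmost unpaired cell of row $i+1$ to row $i$ in the same column; $e_i(D)=0$ if row $i+1$ has no unpaired cell. The lock raising operator: for $T\in\mathrm{LKT}(\mathbf{a})$,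 $e_i(T)$ is the unique element of $\mathrm{LKT}(\mathbf{a})$ with underlying diagram $e_i(\mathbb{D}(T))$ if $e_i(\mathbb{D}(T))\neq0$ and such an element exists, and $e_i(T)=0$ otherwise. -}

module Defs where

open import Data.Nat using (ℕ; zero; suc; _+_; _∸_; _⊔_; _≤_; _<_; _≡ᵇ_)
open import Data.Bool using (Bool; true; false; _∧_; if_then_else_)
open import Data.Fin using (Fin; toℕ)
import Data.Fin as Fin
open import Data.Vec using (Vec; lookup; toList)
open import Data.Vec.Relation.Unary.All using (All)
import Data.Vec.Relation.Unary.All as All
open import Data.List using (List; []; _∷_; map; concatMap; allFin; upTo; last; foldr)
open import Data.Bool.ListAction using (any)
open import Data.List.Membership.Propositional using (_∈_)
open import Data.Maybe using (Maybe; just; nothing)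
open import Data.Product using (_×_; _,_; proj₁; Σ; ∃)
open import Relation.Binary.PropositionalEquality using (_≡_)

-- Diagrams: finite sets of cells (column , row), represented by lists
-- (set semantics: only membership matters).

Cell : Set
Cell = ℕ × ℕ

Diagram : Set
Diagram = List Cell

SameSet : Diagram → Diagram → Set
SameSet D D' = (∀ x → x ∈ D → x ∈ D') × (∀ x → x ∈ D' → x ∈ D)

has : Diagram → ℕ → ℕ → Bool
has D c r = any (λ x → (proj₁ x ≡ᵇ c) ∧ (Data.Product.proj₂ x ≡ᵇ r)) D

maxCol : Diagram → ℕ
maxCol D = foldr (λ x m → proj₁ x ⊔ m) 0 D

-- Vertical i-pairing, scanning columns left to right.  s = number of
-- currently unpaired row-i cells (to the left).  A column containing cells
-- in both rows i, i+1 is paired within the column.  A row-(i+1) cell is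
-- paired with the rightmost unpaired row-i cell to its left (all cells in
-- between being paired) if there is one; otherwise it stays unpaired.
-- Returns the columns of the unpaired cells of row i+1, left to right.
unpairedUpper : ℕ → Diagram → List ℕ
unpairedUpper i D = go 0 (map suc (upTo (maxCol D)))
  where
  step : ℕ → ℕ → Bool → Bool → (ℕ → List ℕ) → List ℕ
  step s c true  true  k = k s
  step s c true  false k = k (suc s)
  step zero    c false true k = c ∷ k zero
  step (suc s) c false true k = k s
  step s c false false k = k s

  go : ℕ → List ℕ → List ℕ
  go s []       = []
  go s (c ∷ cs) = step s c (has D c i) (has D c (suc i)) (λ s' → go s' cs)

-- Raising operator e_i on diagrams: nothing encodes e_i(D) = 0.
raise : ℕ → Diagram → Maybe Diagram
raise i D with last (unpairedUpper i D)
... | nothing = nothing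
... | just c  = just (map (λ x → if (proj₁ x ≡ᵇ c) ∧ (Data.Product.proj₂ x ≡ᵇ suc i)
                                   then (c , i) else x) D)

-- Lock Kohnert tableaux of content a.
-- By condition (1), a labeled diagram of content a is given by recording,
-- for each label i (Fin index k, label = suc (toℕ k)) and each of its
-- columns M-a_i+1, ..., M (j-th one, j : Fin a_i, left to right),
-- the row of the unique cell labeled i in that column.

maxPart : ∀ {n} → Vec ℕ n → ℕ
maxPart a = foldr _⊔_ 0 (toList a)

Filling : ∀ {n} → Vec ℕ n → Set
Filling a = All (λ m → Vec ℕ m) a

label : ∀ {n} → Fin n → ℕ
label k = suc (toℕ k)

col : ∀ {n} (a : Vec ℕ n) (k : Fin n) → Fin (lookup a k) → ℕ
col a k j = (maxPart a ∸ lookup a k) + suc (toℕ j)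

allLookup : ∀ {n} {a : Vec ℕ n} → Filling a → (k : Fin n) → Vec ℕ (lookup a k)
allLookup (v All.∷ _)  Fin.zero    = v
allLookup (_ All.∷ vs) (Fin.suc k) = allLookup vs k

rowAt : ∀ {n} {a : Vec ℕ n} → Filling a → (k : Fin n) → Fin (lookup a k) → ℕ
rowAt T k j = lookup (allLookup T k) j

diagram : ∀ {n} {a : Vec ℕ n} → Filling a → Diagram
diagram {n} {a} T =
  concatMap (λ k → map (λ j → (col a k j , rowAt T k j)) (allFin (lookup a k)))
            (allFin n)

record IsLKT {n} (a : Vec ℕ n) (T : Filling a) : Set where
  field
    rowPos : ∀ k j → 1 ≤ rowAt T k j
    cond2  : ∀ k j → rowAt T k j ≤ label k
    cond3  : ∀ k (j j' : Fin (lookup a k)) → toℕ j < toℕ j' → rowAt T k j' ≤ rowAt T k j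
    -- (4) labels strictly decrease going down each column (in particular
    -- distinct labels occupy distinct cells)
    cond4  : ∀ k k' (j : Fin (lookup a k)) (j' : Fin (lookup a k')) →
             col a k j ≡ col a k' j' → toℕ k < toℕ k' → rowAt T k j < rowAt T k' j'

-- T' = e_i(T) (lock raising) with 1 ≤ i < n and e_i(T) ≠ 0: T' is the
-- element of LKT(a) whose underlying diagram is e_i(D(T)) ≠ 0.
LockEdge : ∀ {n} (a : Vec ℕ n) → Filling a → Filling a → Set
LockEdge {n} a T T' =
  IsLKT a T × IsLKT a T' ×
  Σ ℕ (λ i → 1 ≤ i × i < n ×
    Σ Diagram (λ D' → raise i (diagram T) ≡ just D' × SameSet (diagram T') D'))

{-# OPTIONS --safe #-}
module Submission where

-- Every tableau is connected to the one that is minimal cell by cell.  Lowering alone does not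
-- suffice: for a = (0,0,3,1,2) some other tableau has all e_i = 0.  Let k be the smallest
-- label not yet in its minimal row ρ, and let suc i > ρ be the row of its leftmost cell.  First
-- apply the inverses of e_ρ, …, e_i as long as they apply; they preserve the tableau conditions,
-- since the labels moved are at least k and stay in rows ≤ suc i ≤ k.  In the end each cell in
-- a row ρ, …, i has a cell directly above it.  In every column where k lies in a row ≤ i there
-- is then a cell in row i, and no cell in row i lies to the left of these columns, so that e_i
-- lowers exactly the cells of label k in row suc i, from right to left.  Iterating brings k to
-- row ρ; the smaller labels, all in rows below ρ, are never touched.

open import Defs
open import Data.Nat using (ℕ; zero; suc; pred; _+_; _∸_; _≤_; _<_; _≡ᵇ_; z≤n; s≤s; z<s; s≤s⁻¹; s<s⁻¹; _≤?_; _<?_)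
open import Data.Nat.Properties hiding (_≟_)
open import Data.Nat.Induction using (<-wellFounded)
open import Induction.WellFounded using (Acc; acc)
import Data.Nat.Properties as ℕ
open import Data.Bool using (Bool; true; false; _∧_; if_then_else_; T)
open import Data.Bool.Properties using (T-∧; T-≡; ¬-not)
open import Data.Fin using (Fin; toℕ; fromℕ<)
import Data.Fin as Fin
import Data.Fin.Properties as Fin
open import Data.Vec using (Vec; []; _∷_; lookup; tabulate)
open import Data.Vec.Properties using (lookup∘tabulate; tabulate∘lookup; tabulate-cong)
import Data.Vec.Relation.Unary.All as All
open import Data.List using (List; []; _∷_; _++_; _∷ʳ_; map; allFin; upTo; last; foldl)
open import Data.List.Properties using (foldl-∷ʳ; map-++; upTo-∷ʳ; map-concatMap; concatMap-cong; map-cong; map-∘; ++-identityʳ)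
open import Data.List.Relation.Unary.Any using (here; there)
import Data.List.Relation.Unary.Any as Any
import Data.List.Relation.Unary.Any.Properties as Any
open import Data.List.Membership.Propositional using (_∈_; lose)
open import Data.List.Membership.Propositional.Properties using (∈-map⁺; ∈-map⁻; ∈-concatMap⁺; ∈-concatMap⁻; ∈-allFin)
open import Data.Maybe using (just)
open import Data.Product using (_×_; _,_; proj₁; proj₂; ∃)
open import Data.Sum using (_⊎_; inj₁; inj₂)
open import Data.Empty using (⊥)
open import Function using (_∘_; Equivalence)
open import Relation.Nullary using (¬_; Dec; yes; no; contradiction; _×-dec_; ¬?)
open import Relation.Binary using (tri<; tri≈; tri>)
open import Relation.Binary.PropositionalEquality using (_≡_; _≢_; refl; sym; trans; cong; cong₂; subst; subst₂; module ≡-Reasoning)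
open import Relation.Binary.Construct.Closure.ReflexiveTransitive using (Star; ε; _◅_; _◅◅_; reverse; gmap)
open import Relation.Binary.Construct.Closure.Symmetric using (SymClosure; fwd; bwd; symmetric)

-- The pairing scan and the count of unpaired cells

-- The scanning loop of unpairedUpper is local to Defs; unification recovers it.
mutual
  scan : ℕ → Diagram → ℕ → List ℕ → List ℕ
  scan = _

  unpairedUpper-scan : ∀ i D → unpairedUpper i D ≡ scan i D 0 (map suc (upTo (maxCol D)))
  -- The column list and the initial count become variables, so that `scan` is applied to distinct
  -- variables only and the unifier has exactly one solution.
  unpairedUpper-scan i D with map suc (upTo (maxCol D))
  ... | cs with 0
  ... | z = refl

-- excess p q c counts the unpaired lower-row cells among columns 1, …, c, where p and q are
-- the indicators of the lower and of the upper row; Emits p q c is about column suc c.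
bump : Bool → Bool → ℕ → ℕ
bump true  true  s = s
bump true  false s = suc s
bump false true  s = pred s
bump false false s = s

excess : (p q : ℕ → Bool) → ℕ → ℕ
excess p q zero    = 0
excess p q (suc c) = bump (p (suc c)) (q (suc c)) (excess p q c)

Emits : (p q : ℕ → Bool) → ℕ → Set
Emits p q c = excess p q c ≡ 0 × p (suc c) ≡ false × q (suc c) ≡ true

-- Growing at the right end, the list follows the recursion of `excess` and exposes the column that
-- `last` looks at.
columns : ℕ → List ℕ
columns zero    = []
columns (suc m) = columns m ∷ʳ suc m

columns≡map-suc-upTo : ∀ m → columns m ≡ map suc (upTo m)
columns≡map-suc-upTo zero    = refl
columns≡map-suc-upTo (suc m) = begin
  columns m ∷ʳ suc m          ≡⟨ cong (_∷ʳ suc m) (columns≡map-suc-upTo m) ⟩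
  map suc (upTo m) ∷ʳ suc m   ≡⟨ map-++ suc (upTo m) (m ∷ []) ⟨
  map suc (upTo m ∷ʳ m)       ≡⟨ cong (map suc) (upTo-∷ʳ m) ⟩
  map suc (upTo (suc m))      ∎
  where open ≡-Reasoning

last-∷ʳ : ∀ {A : Set} (xs : List A) x → last (xs ∷ʳ x) ≡ just x
last-∷ʳ []           x = refl
last-∷ʳ (_ ∷ [])     x = refl
last-∷ʳ (_ ∷ y ∷ xs) x = last-∷ʳ (y ∷ xs) x

module _ (i : ℕ) (D : Diagram) where

  private
    p q : ℕ → Bool
    p c = has D c i
    q c = has D c (suc i)

    next : ℕ → ℕ → ℕ
    next s c = bump (p c) (q c) s

  scan-++ : ∀ cs s ds → scan i D s (cs ++ ds) ≡ scan i D s cs ++ scan i D (foldl next s cs) ds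
  scan-++ [] s ds = refl
  scan-++ (c ∷ cs) s ds with has D c i | has D c (suc i)
  ... | true  | true  = scan-++ cs s ds
  ... | true  | false = scan-++ cs (suc s) ds
  scan-++ (c ∷ cs) zero    ds | false | false = scan-++ cs zero ds
  scan-++ (c ∷ cs) (suc s) ds | false | false = scan-++ cs (suc s) ds
  scan-++ (c ∷ cs) zero    ds | false | true = cong (c ∷_) (scan-++ cs zero ds)
  scan-++ (c ∷ cs) (suc s) ds | false | true = scan-++ cs s ds

  scan-emits : ∀ c → p c ≡ false → q c ≡ true → scan i D 0 (c ∷ []) ≡ c ∷ []
  scan-emits c pc qc rewrite pc | qc = refl

  scan-silent : ∀ s c → ¬ (s ≡ 0 × p c ≡ false × q c ≡ true) → scan i D s (c ∷ []) ≡ []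
  scan-silent s c silent with has D c i | has D c (suc i)
  ... | true  | true  = refl
  ... | true  | false = refl
  scan-silent zero    c silent | false | false = refl
  scan-silent (suc s) c silent | false | false = refl
  scan-silent zero    c silent | false | true = contradiction (refl , refl , refl) silent
  scan-silent (suc s) c silent | false | true = refl

  foldl-excess : ∀ m → foldl next 0 (columns m) ≡ excess p q m
  foldl-excess zero = refl
  foldl-excess (suc m) rewrite foldl-∷ʳ next 0 (suc m) (columns m) | foldl-excess m = refl

  scan-columns-suc : ∀ m → scan i D 0 (columns (suc m)) ≡
                     scan i D 0 (columns m) ++ scan i D (excess p q m) (suc m ∷ [])
  scan-columns-suc m rewrite sym (foldl-excess m) = scan-++ (columns m) 0 (suc m ∷ [])

  -- Silent columns at the right end are peeled off until column `suc x` is the last one. The shift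
  -- by one arises because `Emits` at `x` reads the count before column `suc x`.
  last-scan : ∀ m x → x < m → Emits p q x → (∀ y → x < y → ¬ Emits p q y) →
              last (scan i D 0 (columns m)) ≡ just (suc x)
  last-scan (suc m) x x<m e silent rewrite scan-columns-suc m with x ℕ.≟ m
  ... | yes refl rewrite proj₁ e | scan-emits (suc x) (proj₁ (proj₂ e)) (proj₂ (proj₂ e)) =
    last-∷ʳ (scan i D 0 (columns m)) (suc x)
  ... | no x≢m
    rewrite scan-silent (excess p q m) (suc m) (silent m (≤∧≢⇒< (s≤s⁻¹ x<m) x≢m))
          | ++-identityʳ (scan i D 0 (columns m)) =
    last-scan m x (≤∧≢⇒< (s≤s⁻¹ x<m) x≢m) e silent

-- How the count changes when one cell is raised

excess-zero : ∀ p q x → (∀ c → c ≤ x → p c ≡ false) → excess p q x ≡ 0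
excess-zero p q zero    none = refl
excess-zero p q (suc x) none
  rewrite none (suc x) ≤-refl | excess-zero p q x (λ c c≤x → none c (m≤n⇒m≤1+n c≤x)) with q (suc x)
... | true  = refl
... | false = refl

module _ (p q : ℕ → Bool) where

  -- Only a lower cell without an upper cell takes the count from zero to a positive value. The last
  -- such rise marks the leftmost lower cell that columns 1, ..., `d` leave unpaired, which is the
  -- cell that the inverse of a raising operator moves.
  last-rise : ∀ d → 0 < excess p q d →
    ∃ λ x → x < d × excess p q x ≡ 0 × p (suc x) ≡ true × q (suc x) ≡ false ×
            (∀ y → x < y → y ≤ d → 0 < excess p q y)
  last-rise (suc d) pos with excess p q d in eq
  last-rise (suc d) pos | zero with p (suc d) in pd | q (suc d) in qd
  ... | true | false = d , ≤-refl , eq , pd , qd , later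
    where
    later : ∀ y → d < y → y ≤ suc d → 0 < excess p q y
    later y d<y y≤d rewrite ≤-antisym y≤d d<y | pd | qd = z<s
  last-rise (suc d) () | zero | true | true
  last-rise (suc d) pos | suc e with last-rise d (subst (0 <_) (sym eq) z<s)
  ... | x , x<d , ex , px , qx , later = x , m<n⇒m<1+n x<d , ex , px , qx , later′
    where
    later′ : ∀ y → x < y → y ≤ suc d → 0 < excess p q y
    later′ y x<y y≤d with m≤n⇒m<n∨m≡n y≤d
    ... | inj₁ y<d  = later y x<y (s≤s⁻¹ y<d)
    ... | inj₂ refl = subst (λ e′ → 0 < bump (p (suc d)) (q (suc d)) e′) (sym eq) pos

  module _ (p⁺ q⁺ : ℕ → Bool) (x d : ℕ)
           (agree : ∀ c → c ≢ suc x → p⁺ c ≡ p c × q⁺ c ≡ q c)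
           (px : p (suc x) ≡ true) (qx : q (suc x) ≡ false)
           (p⁺x : p⁺ (suc x) ≡ false) (q⁺x : q⁺ (suc x) ≡ true)
           (ex : excess p q x ≡ 0)
           (later : ∀ y → x < y → y ≤ d → 0 < excess p q y) where

    excess-before : ∀ y → y ≤ x → excess p⁺ q⁺ y ≡ excess p q y
    excess-before zero    y≤x = refl
    excess-before (suc y) y≤x
      rewrite proj₁ (agree (suc y) (<⇒≢ (s≤s y≤x))) | proj₂ (agree (suc y) (<⇒≢ (s≤s y≤x)))
            | excess-before y (<⇒≤ y≤x) = refl

    -- Raising the cell in column `suc x` removes one unit of count. Since `later` keeps the old
    -- count positive, the truncation in `pred` never absorbs this difference, and it persists up to
    -- `d`.
    excess-after : ∀ y → x < y → y ≤ d → excess p q y ≡ suc (excess p⁺ q⁺ y)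
    excess-after (suc y) x<y y≤d with y ℕ.≟ x
    ... | yes refl rewrite px | qx | p⁺x | q⁺x | excess-before x ≤-refl | ex = refl
    ... | no y≢x with excess-after y (≤∧≢⇒< (s≤s⁻¹ x<y) (y≢x ∘ sym)) (<⇒≤ y≤d)
                    | agree (suc y) (y≢x ∘ suc-injective) | later (suc y) x<y y≤d
    ... | eq | pe , qe | pos rewrite pe | qe | eq with p (suc y) | q (suc y)
    ...   | true  | true  = refl
    ...   | true  | false = refl
    ...   | false | false = refl
    ...   | false | true  with excess p⁺ q⁺ y
    ...     | suc e = refl

    -- An emission needs new count zero, hence old count one; the same upper cell would then bring
    -- the old count to zero, against `later`.
    silent-after : ∀ y → x < y → y < d → ¬ Emits p⁺ q⁺ y
    silent-after y x<y y<d (e⁺ , p⁺y , q⁺y)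
      with excess-after y x<y (<⇒≤ y<d) | agree (suc y) (>⇒≢ (s≤s x<y)) | later (suc y) (m<n⇒m<1+n x<y) y<d
    ... | eq | pe , qe | pos rewrite sym pe | sym qe | p⁺y | q⁺y | eq | e⁺ with pos
    ... | ()

    emits-at : Emits p⁺ q⁺ x
    emits-at = trans (excess-before x ≤-refl) ex , p⁺x , q⁺x

-- Membership in diagrams and the lowering of a cell

has⇒∈ : ∀ D c r → has D c r ≡ true → (c , r) ∈ D
has⇒∈ D c r eq = Any.map cell (Any.any⁻ _ D (Equivalence.from T-≡ eq))
  where
  cell : ∀ {x : Cell} → T ((proj₁ x ≡ᵇ c) ∧ (proj₂ x ≡ᵇ r)) → (c , r) ≡ x
  cell {x} t = cong₂ _,_ (sym (≡ᵇ⇒≡ _ _ (proj₁ (Equivalence.to T-∧ t))))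
                         (sym (≡ᵇ⇒≡ _ _ (proj₂ (Equivalence.to (T-∧ {proj₁ x ≡ᵇ c}) t))))

∈⇒has : ∀ D c r → (c , r) ∈ D → has D c r ≡ true
∈⇒has D c r mem = Equivalence.to T-≡ (Any.any⁺ _ (Any.map cell mem))
  where
  cell : ∀ {x : Cell} → (c , r) ≡ x → T ((proj₁ x ≡ᵇ c) ∧ (proj₂ x ≡ᵇ r))
  cell refl = Equivalence.from T-∧ (≡⇒≡ᵇ c c refl , ≡⇒≡ᵇ r r refl)

∈⇒≤maxCol : ∀ {D c r} → (c , r) ∈ D → c ≤ maxCol D
∈⇒≤maxCol (here refl)            = m≤m⊔n _ _
∈⇒≤maxCol {x ∷ D} (there mem) = ≤-trans (∈⇒≤maxCol mem) (m≤n⊔m (proj₁ x) _)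

lowerCell : ℕ → ℕ → Cell → Cell
lowerCell c i x = if (proj₁ x ≡ᵇ c) ∧ (proj₂ x ≡ᵇ suc i) then (c , i) else x

raise-just : ∀ i D c → last (unpairedUpper i D) ≡ just c → raise i D ≡ just (map (lowerCell c i) D)
raise-just i D c eq rewrite eq = refl

lowerCell-hit : ∀ c i → lowerCell c i (c , suc i) ≡ (c , i)
lowerCell-hit c i rewrite Equivalence.to T-≡ (≡⇒≡ᵇ c c refl) | Equivalence.to T-≡ (≡⇒≡ᵇ i i refl) = refl

lowerCell-miss : ∀ c i d r → ¬ (d ≡ c × r ≡ suc i) → lowerCell c i (d , r) ≡ (d , r)
lowerCell-miss c i d r miss with d ≡ᵇ c in eq | r ≡ᵇ suc i in eq′
... | true  | true  = contradiction (≡ᵇ⇒≡ d c (Equivalence.from T-≡ eq) , ≡ᵇ⇒≡ r (suc i) (Equivalence.from T-≡ eq′)) miss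
... | true  | false = refl
... | false | _     = refl

-- Finite sums, and fillings given by functions

∑ : ∀ {n} → (Fin n → ℕ) → ℕ
∑ {zero}  f = 0
∑ {suc n} f = f Fin.zero + ∑ (f ∘ Fin.suc)

∑-mono-≤ : ∀ {n} (f g : Fin n → ℕ) → (∀ k → f k ≤ g k) → ∑ f ≤ ∑ g
∑-mono-≤ {zero}  f g f≤g = z≤n
∑-mono-≤ {suc n} f g f≤g = +-mono-≤ (f≤g Fin.zero) (∑-mono-≤ _ _ (f≤g ∘ Fin.suc))

∑-mono-< : ∀ {n} (f g : Fin n → ℕ) → (∀ k → f k ≤ g k) → ∀ k → f k < g k → ∑ f < ∑ g
∑-mono-< f g f≤g Fin.zero    lt = +-mono-<-≤ lt (∑-mono-≤ _ _ (f≤g ∘ Fin.suc))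
∑-mono-< f g f≤g (Fin.suc k) lt = +-mono-≤-< (f≤g Fin.zero) (∑-mono-< _ _ (f≤g ∘ Fin.suc) k lt)

fillBy : ∀ {n} {a : Vec ℕ n} → ((k : Fin n) → Fin (lookup a k) → ℕ) → Filling a
fillBy {a = []}    g = All.[]
fillBy {a = m ∷ a} g = tabulate (g Fin.zero) All.∷ fillBy (λ k → g (Fin.suc k))

rowAt-fillBy : ∀ {n} {a : Vec ℕ n} (g : (k : Fin n) → Fin (lookup a k) → ℕ) k j → rowAt {a = a} (fillBy g) k j ≡ g k j
rowAt-fillBy {a = m ∷ a} g Fin.zero    j = lookup∘tabulate (g Fin.zero) j
rowAt-fillBy {a = m ∷ a} g (Fin.suc k) j = rowAt-fillBy {a = a} (λ k → g (Fin.suc k)) k j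

fillBy-rowAt : ∀ {n} {a : Vec ℕ n} (S : Filling a) (g : (k : Fin n) → Fin (lookup a k) → ℕ) →
               (∀ k j → g k j ≡ rowAt S k j) → fillBy g ≡ S
fillBy-rowAt {a = []}    All.[]       g eq = refl
fillBy-rowAt {a = m ∷ a} (v All.∷ vs) g eq =
  cong₂ All._∷_ (trans (tabulate-cong (eq Fin.zero)) (tabulate∘lookup v))
                (fillBy-rowAt vs (λ k → g (Fin.suc k)) (λ k → eq (Fin.suc k)))

lookup≤maxPart : ∀ {n} (a : Vec ℕ n) k → lookup a k ≤ maxPart a
lookup≤maxPart (m ∷ a) Fin.zero    = m≤m⊔n m _
lookup≤maxPart (m ∷ a) (Fin.suc k) = ≤-trans (lookup≤maxPart a k) (m≤n⊔m m _)

-- Tableaux as row functions of label and column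

module _ {n : ℕ} (a : Vec ℕ n) where

  M : ℕ
  M = maxPart a

  start : Fin n → ℕ
  start k = M ∸ lookup a k

  InCols : Fin n → ℕ → Set
  InCols k c = start k < c × c ≤ M

  -- Total functions of the actual column number: cells of different labels in one column can be
  -- compared without the dependent `Fin (lookup a k)`. Only values on `InCols` carry meaning.
  Rows : Set
  Rows = Fin n → ℕ → ℕ

  fill : Rows → Filling a
  fill R = fillBy (λ k j → R k (col a k j))

  Has : Rows → ℕ → ℕ → Set
  Has R c r = ∃ λ k → InCols k c × R k c ≡ r

  InCols? : ∀ k c → Dec (InCols k c)
  InCols? k c = (start k <? c) ×-dec (c ≤? M)

  Has? : ∀ R c r → Dec (Has R c r)
  Has? R c r = Fin.any? (λ k → InCols? k c ×-dec (R k c ℕ.≟ r))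

  col-InCols : ∀ k j → InCols k (col a k j)
  col-InCols k j = m<m+n (start k) z<s ,
    ≤-trans (+-monoʳ-≤ (start k) (Fin.toℕ<n j)) (≤-reflexive (m∸n+n≡m (lookup≤maxPart a k)))

  index : ∀ {k c} → InCols k c → ∃ λ j → col a k j ≡ c
  index {k} {c} (s<c , c≤M) = fromℕ< lt , trans (cong (λ t → start k + suc t) (Fin.toℕ-fromℕ< lt)) eq
    where
    eq : start k + suc (c ∸ suc (start k)) ≡ c
    eq = trans (+-suc (start k) _) (m+[n∸m]≡n s<c)
    lt : c ∸ suc (start k) < lookup a k
    lt = +-cancelˡ-≤ (start k) _ _ (≤-trans (≤-reflexive eq)
           (≤-trans c≤M (≤-reflexive (sym (m∸n+n≡m (lookup≤maxPart a k))))))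

  col-injective : ∀ k j j′ → col a k j ≡ col a k j′ → j ≡ j′
  col-injective k j j′ eq = Fin.toℕ-injective (suc-injective (+-cancelˡ-≡ (start k) _ _ eq))

  InCols-right : ∀ {k c d} → InCols k c → c ≤ d → d ≤ M → InCols k d
  InCols-right (s<c , _) c≤d d≤M = <-≤-trans s<c c≤d , d≤M

  record Valid (R : Rows) : Set where
    field
      positive : ∀ {k c} → InCols k c → 1 ≤ R k c
      bounded  : ∀ {k c} → InCols k c → R k c ≤ label k
      descends : ∀ {k c d} → InCols k c → c ≤ d → d ≤ M → R k d ≤ R k c
      strict   : ∀ {k l c} → InCols k c → InCols l c → toℕ k < toℕ l → R k c < R l c

    injective : ∀ {k l c} → InCols k c → InCols l c → R k c ≡ R l c → k ≡ l
    injective {k} {l} kc lc eq with <-cmp (toℕ k) (toℕ l)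
    ... | tri< k<l _ _ = contradiction eq (<⇒≢ (strict kc lc k<l))
    ... | tri≈ _ k≡l _ = Fin.toℕ-injective k≡l
    ... | tri> _ _ l<k = contradiction eq (>⇒≢ (strict lc kc l<k))

    reflects-< : ∀ {k l c} → InCols k c → InCols l c → R k c < R l c → toℕ k < toℕ l
    reflects-< {k} {l} kc lc lt with <-cmp (toℕ k) (toℕ l)
    ... | tri< k<l _ _ = k<l
    ... | tri≈ _ k≡l _ rewrite Fin.toℕ-injective k≡l = contradiction lt (<-irrefl refl)
    ... | tri> _ _ l<k = contradiction lt (<⇒≯ (strict lc kc l<k))

    monotone : ∀ {k l c} → InCols k c → InCols l c → toℕ k ≤ toℕ l → R k c ≤ R l c
    monotone kc lc k≤l with m≤n⇒m<n∨m≡n k≤l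
    ... | inj₁ k<l = <⇒≤ (strict kc lc k<l)
    ... | inj₂ k≡l rewrite Fin.toℕ-injective k≡l = ≤-refl

  open Valid

  rowAt-fill : ∀ R k j → rowAt (fill R) k j ≡ R k (col a k j)
  rowAt-fill R k j = rowAt-fillBy {a = a} (λ k j → R k (col a k j)) k j

  fill-IsLKT : ∀ {R} → Valid R → IsLKT a (fill R)
  fill-IsLKT {R} v = record
    { rowPos = λ k j → subst (1 ≤_) (sym (rowAt-fill R k j)) (positive v (col-InCols k j))
    ; cond2  = λ k j → subst (_≤ label k) (sym (rowAt-fill R k j)) (bounded v (col-InCols k j))
    ; cond3  = λ k j j′ j<j′ → subst₂ _≤_ (sym (rowAt-fill R k j′)) (sym (rowAt-fill R k j))
                 (descends v (col-InCols k j) (+-monoʳ-≤ (start k) (s≤s (<⇒≤ j<j′))) (proj₂ (col-InCols k j′)))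
    ; cond4  = λ k l j j′ eq k<l → subst₂ _<_ (sym (rowAt-fill R k j)) (sym (rowAt-fill R l j′))
                 (subst (λ c → R k (col a k j) < R l c) eq
                   (strict v (col-InCols k j) (subst (InCols l) (sym eq) (col-InCols l j′)) k<l))
    }

  rowsOf : Filling a → Rows
  rowsOf S k c with InCols? k c
  ... | yes kc = rowAt S k (proj₁ (index kc))
  -- A default value; `fill` and `Valid` look only at columns of the label.
  ... | no  _  = 0

  rowsOf-col : ∀ S k j → rowsOf S k (col a k j) ≡ rowAt S k j
  rowsOf-col S k j with InCols? k (col a k j)
  ... | yes kc = cong (rowAt S k) (col-injective k _ j (proj₂ (index kc)))
  ... | no ¬kc = contradiction (col-InCols k j) ¬kc

  fill-rowsOf : ∀ S → fill (rowsOf S) ≡ S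
  fill-rowsOf S = fillBy-rowAt S _ (rowsOf-col S)

  rowsOf-Valid : ∀ {S} → IsLKT a S → Valid (rowsOf S)
  rowsOf-Valid {S} lkt = record
    { positive = pos ; bounded = bnd ; descends = desc ; strict = str }
    where
    open IsLKT lkt
    pos : ∀ {k c} → InCols k c → 1 ≤ rowsOf S k c
    pos {k} kc with index kc
    ... | j , refl rewrite rowsOf-col S k j = rowPos k j
    bnd : ∀ {k c} → InCols k c → rowsOf S k c ≤ label k
    bnd {k} kc with index kc
    ... | j , refl rewrite rowsOf-col S k j = cond2 k j
    desc : ∀ {k c d} → InCols k c → c ≤ d → d ≤ M → rowsOf S k d ≤ rowsOf S k c
    desc {k} {c} {d} kc c≤d d≤M with m≤n⇒m<n∨m≡n c≤d
    ... | inj₂ refl = ≤-refl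
    ... | inj₁ c<d with index kc | index (InCols-right kc c≤d d≤M)
    ...   | j , refl | j′ , refl rewrite rowsOf-col S k j | rowsOf-col S k j′ =
      cond3 k j j′ (s<s⁻¹ (+-cancelˡ-< (start k) _ _ c<d))
    str : ∀ {k l c} → InCols k c → InCols l c → toℕ k < toℕ l → rowsOf S k c < rowsOf S l c
    str {k} {l} kc lc k<l with index kc
    ... | j , refl with index lc
    ...   | j′ , eq = subst₂ _<_ (sym (rowsOf-col S k j))
                       (trans (sym (rowsOf-col S l j′)) (cong (rowsOf S l) eq))
                       (cond4 k l j j′ (sym eq) k<l)

  -- Cells of the diagram and edges of the graph

  has? : Rows → ℕ → ℕ → Bool
  has? R r c = has (diagram (fill R)) c r

  cells : Rows → Fin n → List Cell
  cells R k = map (λ j → (col a k j , rowAt (fill R) k j)) (allFin (lookup a k))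

  Has⇒∈ : ∀ R {c r} → Has R c r → (c , r) ∈ diagram (fill R)
  Has⇒∈ R (k , kc , eq) with index kc
  ... | j , refl = ∈-concatMap⁺ (cells R) {xs = allFin n} (lose (∈-allFin k)
        (subst (λ r → (col a k j , r) ∈ cells R k)
               (trans (rowAt-fill R k j) eq) (∈-map⁺ _ (∈-allFin j))))

  ∈⇒Has : ∀ R {c r} → (c , r) ∈ diagram (fill R) → Has R c r
  ∈⇒Has R mem with Any.satisfied (∈-concatMap⁻ (cells R) {xs = allFin n} mem)
  ... | k , mem′ with ∈-map⁻ (λ j → (col a k j , rowAt (fill R) k j)) mem′
  ...   | j , _ , refl = k , col-InCols k j , sym (rowAt-fill R k j)

  has?-true : ∀ R {c r} → Has R c r → has? R r c ≡ true
  has?-true R h = ∈⇒has _ _ _ (Has⇒∈ R h)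

  has?-sound : ∀ R {c r} → has? R r c ≡ true → Has R c r
  has?-sound R eq = ∈⇒Has R (has⇒∈ _ _ _ eq)

  has?-false : ∀ R {c r} → ¬ Has R c r → has? R r c ≡ false
  has?-false R ¬h = ¬-not (λ eq → ¬h (has?-sound R eq))

  has?-⇔ : ∀ R R′ {c c′ r r′} → (Has R c r → Has R′ c′ r′) → (Has R′ c′ r′ → Has R c r) → has? R r c ≡ has? R′ r′ c′
  has?-⇔ R R′ {c = c} {r = r} to from with Has? R c r
  ... | yes h = trans (has?-true R h) (sym (has?-true R′ (to h)))
  ... | no ¬h = trans (has?-false R ¬h) (sym (has?-false R′ (¬h ∘ from)))

  AgreeOff : Fin n → ℕ → Rows → Rows → Set
  AgreeOff k x R R′ = ∀ l c → ¬ (l ≡ k × c ≡ x) → R l c ≡ R′ l c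

  infix 4 _⟶_
  -- A record, so that `R` and `R′` can be inferred from a step although `LockEdge` sees them only
  -- through `fill`.
  record _⟶_ (R R′ : Rows) : Set where
    constructor edge
    field lockEdge : LockEdge a (fill R) (fill R′)

  lower-edge : ∀ {R R′ k x i} → Valid R → Valid R′ → InCols k (suc x) →
    R k (suc x) ≡ suc i → R′ k (suc x) ≡ i → 1 ≤ i → AgreeOff k (suc x) R R′ →
    Emits (has? R i) (has? R (suc i)) x → (∀ y → x < y → ¬ Emits (has? R i) (has? R (suc i)) y) →
    R ⟶ R′
  lower-edge {R} {R′} {k} {x} {i} v v′ kx row row′ 1≤i agree emits silent =
    edge (fill-IsLKT v , fill-IsLKT v′ , i , 1≤i , i<n , _ , raise-just i D (suc x) last≡ , sets)
    where
    D : Diagram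
    D = diagram (fill R)
    i<n : i < n
    i<n = ≤-trans (≤-reflexive (sym row)) (≤-trans (bounded v kx) (Fin.toℕ<n k))
    last≡ : last (unpairedUpper i D) ≡ just (suc x)
    last≡ = trans (cong last (trans (unpairedUpper-scan i D)
                     (cong (scan i D 0) (sym (columns≡map-suc-upTo (maxCol D))))))
                  (last-scan i D (maxCol D) x (∈⇒≤maxCol (Has⇒∈ R (k , kx , row))) emits silent)
    cell : ∀ l j → lowerCell (suc x) i (col a l j , rowAt (fill R) l j) ≡ (col a l j , rowAt (fill R′) l j)
    cell l j rewrite rowAt-fill R l j | rowAt-fill R′ l j with l Fin.≟ k | col a l j ℕ.≟ suc x
    ... | yes refl | yes eq rewrite eq | row | row′ = lowerCell-hit (suc x) i
    ... | yes refl | no ¬eq rewrite sym (agree l (col a l j) (¬eq ∘ proj₂)) = lowerCell-miss _ _ _ _ (¬eq ∘ proj₁)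
    -- Cells of different labels in one column lie in different rows, so the lowered position
    -- belongs to `k` alone.
    ... | no l≢k   | _ rewrite sym (agree l (col a l j) (l≢k ∘ proj₁)) =
      lowerCell-miss _ _ _ _ λ (eq , eq′) → l≢k (injective v
        (subst (InCols l) eq (col-InCols l j)) kx (trans (trans (cong (R l) (sym eq)) eq′) (sym row)))
    lowered : map (lowerCell (suc x) i) D ≡ diagram (fill R′)
    lowered = trans (map-concatMap (lowerCell (suc x) i) _ (allFin n))
      (concatMap-cong (λ l → trans (sym (map-∘ (allFin (lookup a l)))) (map-cong (cell l) (allFin (lookup a l)))) (allFin n))
    sets : SameSet (diagram (fill R′)) (map (lowerCell (suc x) i) D)
    sets = (λ z → subst (z ∈_) (sym lowered)) , (λ z → subst (z ∈_) lowered)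

  -- Changing the row of one cell

  update : Rows → Fin n → ℕ → ℕ → Rows
  update R k x r l c with l Fin.≟ k | c ℕ.≟ x
  ... | yes _ | yes _ = r
  ... | yes _ | no  _ = R l c
  ... | no  _ | _     = R l c

  update-at : ∀ R k x r → update R k x r k x ≡ r
  update-at R k x r with k Fin.≟ k | x ℕ.≟ x
  ... | yes _   | yes _   = refl
  ... | yes _   | no x≢x  = contradiction refl x≢x
  ... | no k≢k  | _       = contradiction refl k≢k

  update-off : ∀ R k x r → AgreeOff k x R (update R k x r)
  update-off R k x r l c off with l Fin.≟ k | c ℕ.≟ x
  ... | yes l≡k | yes c≡x = contradiction (l≡k , c≡x) off
  ... | yes _   | no  _   = refl
  ... | no  _   | _       = refl

  update-Valid : ∀ {R k x r} → Valid R → 1 ≤ r → r ≤ label k →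
    (∀ {y} → InCols k y → y < x → r ≤ R k y) → (∀ {y} → x < y → y ≤ M → R k y ≤ r) →
    (∀ {l} → InCols l x → toℕ l < toℕ k → R l x < r) →
    (∀ {l} → InCols l x → toℕ k < toℕ l → r < R l x) →
    Valid (update R k x r)
  update-Valid {R} {k} {x} {r} v 1≤r r≤k left right below above = record
    { positive = pos ; bounded = bnd ; descends = desc ; strict = str }
    where
    pos : ∀ {l c} → InCols l c → 1 ≤ update R k x r l c
    pos {l} {c} lc with l Fin.≟ k | c ℕ.≟ x
    ... | yes _ | yes _ = 1≤r
    ... | yes _ | no  _ = positive v lc
    ... | no  _ | _     = positive v lc
    bnd : ∀ {l c} → InCols l c → update R k x r l c ≤ label l
    bnd {l} {c} lc with l Fin.≟ k | c ℕ.≟ x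
    ... | yes refl | yes _ = r≤k
    ... | yes _ | no  _ = bounded v lc
    ... | no  _ | _     = bounded v lc
    desc : ∀ {l c d} → InCols l c → c ≤ d → d ≤ M → update R k x r l d ≤ update R k x r l c
    desc {l} {c} {d} lc c≤d d≤M with l Fin.≟ k | c ℕ.≟ x | d ℕ.≟ x
    ... | yes refl | yes refl | yes _    = ≤-refl
    ... | yes refl | yes refl | no d≢x   = right (≤∧≢⇒< c≤d (d≢x ∘ sym)) d≤M
    ... | yes refl | no c≢x   | yes refl = left lc (≤∧≢⇒< c≤d c≢x)
    ... | yes refl | no _     | no _     = descends v lc c≤d d≤M
    ... | no _     | _        | _        = descends v lc c≤d d≤M
    str : ∀ {l m c} → InCols l c → InCols m c → toℕ l < toℕ m → update R k x r l c < update R k x r m c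
    str {l} {m} {c} lc mc l<m with l Fin.≟ k | m Fin.≟ k | c ℕ.≟ x
    ... | yes refl | yes refl | _        = contradiction l<m (<-irrefl refl)
    ... | yes refl | no _     | yes refl = above mc l<m
    ... | yes refl | no _     | no _     = strict v lc mc l<m
    ... | no _     | yes refl | yes refl = below lc l<m
    ... | no _     | yes refl | no _     = strict v lc mc l<m
    ... | no _     | no _     | _        = strict v lc mc l<m

  -- The total room below the bounds `label k`; it is the termination measure for raising cells.
  slack : Rows → ℕ
  slack R = ∑ λ k → ∑ λ j → label k ∸ R k (col a k j)

  slack-update : ∀ {R k x r} → InCols k x → R k x < r → r ≤ label k → slack (update R k x r) < slack R
  slack-update {R} {k} {x} {r} kx lt r≤k with index kx
  ... | j , refl = ∑-mono-< _ _ (λ l → ∑-mono-≤ _ _ (mono l)) k (∑-mono-< _ _ (mono k) j strictly)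
    where
    mono : ∀ l j′ → label l ∸ update R k x r l (col a l j′) ≤ label l ∸ R l (col a l j′)
    mono l j′ with l Fin.≟ k | col a l j′ ℕ.≟ x
    ... | yes refl | yes eq = ∸-monoʳ-≤ (label l) (subst (λ c → R l c ≤ r) (sym eq) (<⇒≤ lt))
    ... | yes _    | no _   = ≤-refl
    ... | no _     | _      = ≤-refl
    strictly : label k ∸ update R k x r k x < label k ∸ R k x
    strictly rewrite update-at R k x r = ∸-monoʳ-< lt r≤k

  -- The inverse of a raising operator

  -- The gap in column `suc d` makes the count positive there, and `last-rise` selects the cell to
  -- raise. Once raised, it is the rightmost unpaired cell of row `suc j`: up to column `suc d` by
  -- `silent-after`, and further right because `beyond` pairs every cell of row `suc j` within its
  -- column. Hence `e_j` undoes the move.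
  raise-move : ∀ {R d j} → Valid R → 1 ≤ j → Has R (suc d) j → ¬ Has R (suc d) (suc j) →
    (∀ y → suc d < y → Has R y (suc j) → Has R y j) →
    (∀ {l c} → InCols l c → R l c ≡ j → suc j ≤ label l) →
    ∃ λ k → ∃ λ x → InCols k x × R k x ≡ j ×
      Valid (update R k x (suc j)) × update R k x (suc j) ⟶ R
  raise-move {R} {d} {j} v 1≤j occupied vacant beyond room
    with last-rise (has? R j) (has? R (suc j)) (suc d)
           (subst₂ (λ b b′ → 0 < bump b b′ (excess (has? R j) (has? R (suc j)) d))
             (sym (has?-true R occupied)) (sym (has?-false R vacant)) z<s)
  ... | x , x<d , ex , px , qx , later with has?-sound R {suc x} {j} px
  ... | k , kx , row = k , suc x , kx , row , v⁺ ,
        lower-edge v⁺ v kx (update-at R k (suc x) (suc j)) row 1≤j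
          (λ l c off → sym (update-off R k (suc x) (suc j) l c off))
          (emits-at p q p⁺ q⁺ x (suc d) agree px qx p⁺x q⁺x ex later) silent
    where
    R⁺ : Rows
    R⁺ = update R k (suc x) (suc j)
    p q p⁺ q⁺ : ℕ → Bool
    p = has? R j
    q = has? R (suc j)
    p⁺ = has? R⁺ j
    q⁺ = has? R⁺ (suc j)

    vacantₓ : ¬ Has R (suc x) (suc j)
    vacantₓ h = contradiction (trans (sym (has?-true R h)) qx) λ ()

    -- A cell of the same label on the left in row j would be paired within its column by a
    -- larger label, and that label would then occupy the vacant place above the raised cell.
    left′ : ∀ x → excess p q x ≡ 0 → InCols k (suc x) → R k (suc x) ≡ j → ¬ Has R (suc x) (suc j) →
            ∀ {y} → InCols k y → y < suc x → suc j ≤ R k y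
    left′ zero _ _ _ _ (s<y , _) y<1 = contradiction (≤-<-trans z≤n s<y) (<⇒≱ y<1)
    left′ (suc x) ex kx row vac {y} ky y<x with R k (suc x) ℕ.≟ j
    ... | no ¬row = ≤-trans (≤∧≢⇒< (≤-trans (≤-reflexive (sym row)) (descends v kx′ (n≤1+n _) (proj₂ kx))) (¬row ∘ sym))
                            (descends v ky (s≤s⁻¹ y<x) (proj₂ kx′))
      where
      kx′ : InCols k (suc x)
      kx′ = InCols-right ky (s≤s⁻¹ y<x) (<⇒≤ (proj₂ kx))
    ... | yes row′ with has? R (suc j) (suc x) in q′ | has?-true R (k , InCols-right ky (s≤s⁻¹ y<x) (<⇒≤ (proj₂ kx)) , row′)
    ...   | false | p′ rewrite p′ = contradiction ex λ ()
    ...   | true  | _ with has?-sound R {suc x} {suc j} q′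
    ...     | l , lx , rowₗ = contradiction (l , lx′ , ≤-antisym low high) vac
      where
      kx′ : InCols k (suc x)
      kx′ = InCols-right ky (s≤s⁻¹ y<x) (<⇒≤ (proj₂ kx))
      lx′ : InCols l (suc (suc x))
      lx′ = InCols-right lx (n≤1+n _) (proj₂ kx)
      low : R l (suc (suc x)) ≤ suc j
      low = ≤-trans (descends v lx (n≤1+n _) (proj₂ kx)) (≤-reflexive rowₗ)
      high : suc j ≤ R l (suc (suc x))
      high = subst (_< R l (suc (suc x))) row (strict v kx lx′
               (reflects-< v kx′ lx (subst₂ _<_ (sym row′) (sym rowₗ) ≤-refl)))

    v⁺ : Valid R⁺
    v⁺ = update-Valid v (s≤s z≤n) (room kx row) (left′ x ex kx row vacantₓ)
      (λ x<y y≤M → m≤n⇒m≤1+n (≤-trans (descends v kx (<⇒≤ x<y) y≤M) (≤-reflexive row)))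
      (λ lx l<k → m<n⇒m<1+n (subst (_ <_) row (strict v lx kx l<k)))
      (λ {l} lx k<l → ≤∧≢⇒< (subst (_< R l (suc x)) row (strict v kx lx k<l)) (λ eq → vacantₓ (l , lx , sym eq)))

    same : ∀ {c r} → c ≢ suc x → has? R⁺ r c ≡ has? R r c
    same {c} c≢x = has?-⇔ R⁺ R
      (λ (l , lc , eq) → l , lc , trans (update-off R k (suc x) (suc j) l c (c≢x ∘ proj₂)) eq)
      (λ (l , lc , eq) → l , lc , trans (sym (update-off R k (suc x) (suc j) l c (c≢x ∘ proj₂))) eq)

    agree : ∀ c → c ≢ suc x → p⁺ c ≡ p c × q⁺ c ≡ q c
    agree c c≢x = same c≢x , same c≢x

    q⁺x : q⁺ (suc x) ≡ true
    q⁺x = has?-true R⁺ (k , kx , update-at R k (suc x) (suc j))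

    p⁺x : p⁺ (suc x) ≡ false
    p⁺x = has?-false R⁺ λ (l , lx , eq) → absurd (l Fin.≟ k) lx eq
      where
      absurd : ∀ {l} → Dec (l ≡ k) → InCols l (suc x) → R⁺ l (suc x) ≡ j → ⊥
      absurd (yes refl) lx eq = 1+n≢n (trans (sym (update-at R k (suc x) (suc j))) eq)
      absurd {l} (no l≢k) lx eq = l≢k (injective v lx kx
        (trans (update-off R k (suc x) (suc j) l (suc x) (l≢k ∘ proj₁)) (trans eq (sym row))))

    silent : ∀ y → x < y → ¬ Emits p⁺ q⁺ y
    silent y x<y e with y <? suc d
    ... | yes y<d = silent-after p q p⁺ q⁺ x (suc d) agree px qx p⁺x q⁺x ex later y x<y y<d e
    ... | no y≮d with same {suc y} {j} (>⇒≢ (s≤s x<y)) | same {suc y} {suc j} (>⇒≢ (s≤s x<y)) | e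
    ...   | pe | qe | _ , p⁺y , q⁺y = contradiction
              (trans (sym (has?-true R (beyond (suc y) (s≤s (≮⇒≥ y≮d)) (has?-sound R (trans (sym qe) q⁺y)))))
                     (trans (sym pe) p⁺y)) λ ()

  -- Settled labels and lower bounds

  -- Comparing with every tableau avoids naming the minimal rows of the labels below K.
  Settled : ℕ → ℕ → Rows → Set
  Settled ρ K R = ∀ {l c} → InCols l c → toℕ l < K → R l c < ρ × (∀ {R′} → Valid R′ → R l c ≤ R′ l c)

  LowerBound : ℕ → ℕ → Set
  LowerBound ρ K = ∀ {R} → Valid R → ∀ {l c} → InCols l c → K ≤ toℕ l → ρ ≤ R l c

  Settled-update : ∀ {ρ K R k x r} → K ≤ toℕ k → Settled ρ K R → Settled ρ K (update R k x r)
  Settled-update {ρ} {K} {R} {k} {x} {r} K≤k settled {l} {c} lc l<K =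
    subst (λ t → t < ρ × (∀ {R′} → Valid R′ → t ≤ R′ l c))
          (update-off R k x r l c λ { (refl , _) → <⇒≱ l<K K≤k }) (settled lc l<K)

  infix 4 _~_
  _~_ : Rows → Rows → Set
  _~_ = Star (SymClosure _⟶_)

  -- Closing the gaps above row ρ

  module _ (k : Fin n) (ρ : ℕ) (1≤ρ : 1 ≤ ρ) (lb : LowerBound ρ (toℕ k)) (first : InCols k (suc (start k))) where

    module _ (i : ℕ) (ρ≤i : ρ ≤ i) (i<k : suc i ≤ label k) where

      -- In the columns right of d, the cells in rows ρ, …, suc i are stacked up to row suc i.
      Full : Rows → ℕ → Set
      Full R d = ∀ {y j} → d < y → ρ ≤ j → j ≤ i → Has R y j → Has R y (suc j)

      Gap : Rows → ℕ → ℕ → Set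
      Gap R d j = ρ ≤ j × Has R d j × ¬ Has R d (suc j)

      -- The search runs from right to left, so that everything to the right of the gap found is
      -- already `Full`; `fill-gap` derives the hypothesis `beyond` of `raise-move` from this.
      find-gap : ∀ R d → Full R d → Full R 0 ⊎ ∃ λ d′ → ∃ λ j → j ≤ i × Gap R (suc d′) j × Full R (suc d′)
      find-gap R zero    full = inj₁ full
      find-gap R (suc d) full
        with anyUpTo? (λ j → (ρ ≤? j) ×-dec Has? R (suc d) j ×-dec ¬? (Has? R (suc d) (suc j))) (suc i)
      ... | yes (j , j<i , gap) = inj₂ (d , j , s≤s⁻¹ j<i , gap , full)
      ... | no none = find-gap R d full′
        where
        full′ : Full R d
        full′ {y} {j} d<y ρ≤j j≤i h with m≤n⇒m<n∨m≡n d<y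
        ... | inj₁ d′<y = full d′<y ρ≤j j≤i h
        ... | inj₂ refl with Has? R (suc d) (suc j)
        ...   | yes h′ = h′
        ...   | no ¬h′ = contradiction (j , s≤s j≤i , ρ≤j , h , ¬h′) none

      climb : ∀ {R d y r} → Full R d → d < y → ρ ≤ r → Has R y r → ∀ m → r ≤ m → m ≤ suc i → Has R y m
      climb full d<y ρ≤r h zero    z≤n _ = h
      climb full d<y ρ≤r h (suc m) r≤m m≤i with m≤n⇒m<n∨m≡n r≤m
      ... | inj₁ r<m  = full d<y (≤-trans ρ≤r (s≤s⁻¹ r<m)) (s≤s⁻¹ m≤i)
                             (climb full d<y ρ≤r h m (s≤s⁻¹ r<m) (m≤n⇒m≤1+n (s≤s⁻¹ m≤i)))
      ... | inj₂ refl = h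

      high-label : ∀ {R l c} → Settled ρ (toℕ k) R → InCols l c → ρ ≤ R l c → toℕ k ≤ toℕ l
      high-label settled lc ρ≤ = ≮⇒≥ λ l<k → <⇒≱ (proj₁ (settled lc l<k)) ρ≤

      fill-gap : ∀ {R d j} → Valid R → Settled ρ (toℕ k) R → R k (suc (start k)) ≡ suc i →
        j ≤ i → Gap R (suc d) j → Full R (suc d) →
        ∃ λ R′ → Valid R′ × Settled ρ (toℕ k) R′ × R′ k (suc (start k)) ≡ suc i ×
                 R′ ⟶ R × slack R′ < slack R
      fill-gap {R} {d} {j} v settled top j≤i (ρ≤j , (m , md , rowₘ) , vacant) full
        = from-move (raise-move v (≤-trans 1≤ρ ρ≤j) (m , md , rowₘ) vacant beyond room)
        where
        k≤m : toℕ k ≤ toℕ m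
        k≤m = high-label settled md (≤-trans ρ≤j (≤-reflexive (sym rowₘ)))
        kd : InCols k (suc d)
        kd with start k <? suc d
        ... | yes s<d = s<d , proj₂ md
        -- If column `suc d` were left of the columns of `k`, label `m` would reach the first of
        -- these at row `suc i` or higher, and could not lie in row `j` further left.
        ... | no s≮d = contradiction
                (≤-trans (subst (_≤ R m (suc (start k))) top (monotone v first ms k≤m))
                (≤-trans (descends v md d≤s (proj₂ first)) (≤-reflexive rowₘ))) (<⇒≱ (s≤s j≤i))
          where
          d≤s : suc d ≤ suc (start k)
          d≤s = m≤n⇒m≤1+n (≮⇒≥ s≮d)
          ms : InCols m (suc (start k))
          ms = InCols-right md d≤s (proj₂ first)
        beyond : ∀ y → suc d < y → Has R y (suc j) → Has R y j
        -- In column `y`, label `k` lies at or above row `ρ`, and at or below row `j` because `m`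
        -- does. Fullness stacks cells from there up to row `j`.
        beyond y d<y (_ , (_ , y≤M) , _) =
          climb full d<y (lb v ky ≤-refl) (k , ky , refl) j
            (≤-trans (monotone v ky (InCols-right md (<⇒≤ d<y) y≤M) k≤m)
                     (≤-trans (descends v md (<⇒≤ d<y) y≤M) (≤-reflexive rowₘ)))
            (m≤n⇒m≤1+n j≤i)
          where
          ky : InCols k y
          ky = InCols-right kd (<⇒≤ d<y) y≤M
        room : ∀ {l c} → InCols l c → R l c ≡ j → suc j ≤ label l
        room lc rowₗ = ≤-trans (s≤s j≤i) (≤-trans i<k
          (s≤s (high-label settled lc (≤-trans ρ≤j (≤-reflexive (sym rowₗ))))))
        from-move : (∃ λ l → ∃ λ x → InCols l x × R l x ≡ j ×
                       Valid (update R l x (suc j)) × update R l x (suc j) ⟶ R) →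
                    ∃ λ R′ → Valid R′ × Settled ρ (toℕ k) R′ × R′ k (suc (start k)) ≡ suc i ×
                             R′ ⟶ R × slack R′ < slack R
        from-move (l , x , lx , rowₗ , v′ , step) =
          update R l x (suc j) , v′ , Settled-update k≤l settled , trans (sym kept) top , step ,
          slack-update lx (s≤s (≤-reflexive rowₗ)) (≤-trans (≤-trans (s≤s j≤i) i<k) (s≤s k≤l))
          where
          k≤l : toℕ k ≤ toℕ l
          k≤l = high-label settled lx (≤-trans ρ≤j (≤-reflexive (sym rowₗ)))
          kept : R k (suc (start k)) ≡ update R l x (suc j) k (suc (start k))
          kept = update-off R l x (suc j) k (suc (start k)) λ { (refl , refl) → <⇒≢ (s≤s j≤i) (trans (sym rowₗ) top) }

      fill-gaps : ∀ {R} → Valid R → Settled ρ (toℕ k) R → R k (suc (start k)) ≡ suc i → Acc _<_ (slack R) →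
        ∃ λ R′ → R ~ R′ × Valid R′ × Settled ρ (toℕ k) R′ × R′ k (suc (start k)) ≡ suc i × Full R′ 0
      fill-gaps {R} v settled top (acc rec) = continue (find-gap R M beyond)
        where
        beyond : Full R M
        beyond M<y _ _ (_ , (_ , y≤M) , _) = contradiction y≤M (<⇒≱ M<y)
        continue : (Full R 0 ⊎ ∃ λ d → ∃ λ j → j ≤ i × Gap R (suc d) j × Full R (suc d)) →
          ∃ λ R′ → R ~ R′ × Valid R′ × Settled ρ (toℕ k) R′ × R′ k (suc (start k)) ≡ suc i × Full R′ 0
        continue (inj₁ full) = R , ε , v , settled , top , full
        continue (inj₂ (d , j , j≤i , gap , full)) =
          let R₁ , v₁ , settled₁ , top₁ , step , less = fill-gap v settled top j≤i gap full
              R₂ , path , rest = fill-gaps v₁ settled₁ top₁ (rec less)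
          -- The edge starts at the raised tableau and is traversed backwards.
          in R₂ , bwd step ◅ path , rest

      -- Lowering a label by one row

      -- A cell in row `i` of a column up to `suc c` would have a label at least `k`. Descending, it
      -- would lie in row `i` or lower in column `suc c`, where `k` is already in row `suc i`. So
      -- the count before column `suc c` is zero and its cell is unpaired. Further right, `done` and
      -- `paired` put a cell in row `i` of every column of `k`, so nothing is emitted there.
      lower-move : ∀ {R c} → Valid R → Settled ρ (toℕ k) R →
        (∀ {y} → InCols k y → R k y ≤ i → Has R y i) →
        (∀ {y} → InCols k y → suc c < y → R k y ≤ i) →
        InCols k (suc c) → R k (suc c) ≡ suc i →
        Valid (update R k (suc c) i) × R ⟶ update R k (suc c) i
      lower-move {R} {c} v settled paired done kc top =
        v′ , lower-edge v v′ kc top (update-at R k (suc c) i) (≤-trans 1≤ρ ρ≤i) (update-off R k (suc c) i)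
               (excess-zero (has? R i) (has? R (suc i)) c (λ y y≤c → has?-false R (vacant y (m≤n⇒m≤1+n y≤c))) ,
                has?-false R (vacant (suc c) ≤-refl) , has?-true R (k , kc , top))
               silent
        where
        vacant : ∀ y → y ≤ suc c → ¬ Has R y i
        vacant y y≤c (l , ly , rowₗ) = contradiction
          (≤-trans (subst (_≤ R l (suc c)) top (monotone v kc (InCols-right ly y≤c (proj₂ kc))
                     (high-label settled ly (≤-trans ρ≤i (≤-reflexive (sym rowₗ))))))
                   (≤-trans (descends v ly y≤c (proj₂ kc)) (≤-reflexive rowₗ)))
          (<-irrefl refl)
        v′ : Valid (update R k (suc c) i)
        v′ = update-Valid v (≤-trans 1≤ρ ρ≤i) (<⇒≤ i<k)
          (λ {y} ky y<c → ≤-trans (n≤1+n i) (subst (_≤ R k y) top (descends v ky (<⇒≤ y<c) (proj₂ kc))))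
          (λ c<y y≤M → done (InCols-right kc (<⇒≤ c<y) y≤M) c<y)
          (λ lc l<k → <-≤-trans (proj₁ (settled lc l<k)) ρ≤i)
          (λ {l} lc k<l → <-trans (n<1+n i) (subst (_< R l (suc c)) top (strict v kc lc k<l)))
        silent : ∀ y → c < y → ¬ Emits (has? R i) (has? R (suc i)) y
        silent y c<y (_ , py , qy) with has?-sound R {suc y} {suc i} qy
        ... | _ , (_ , y≤M) , _ = contradiction
              (trans (sym (has?-true R (paired ky (done ky (s≤s c<y))))) py) λ ()
          where
          ky : InCols k (suc y)
          ky = InCols-right kc (s≤s (<⇒≤ c<y)) y≤M

      -- The sweep goes from right to left, as `e_i` takes the rightmost unpaired cell and the rows
      -- of `k` must keep descending. Pairing survives each move: in the changed column `k` itself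
      -- now occupies row `i`.
      lower-row : ∀ c {R} → Valid R → Settled ρ (toℕ k) R →
        (∀ {y} → InCols k y → R k y ≤ suc i) →
        (∀ {y} → InCols k y → R k y ≤ i → Has R y i) →
        (∀ {y} → InCols k y → c < y → R k y ≤ i) →
        ∃ λ R′ → R ~ R′ × Valid R′ × Settled ρ (toℕ k) R′ × (∀ {y} → InCols k y → R′ k y ≤ i)
      lower-row zero {R} v settled bound paired done =
        R , ε , v , settled , λ ky → done ky (≤-<-trans z≤n (proj₁ ky))
      lower-row (suc c) {R} v settled bound paired done = by-cases (InCols? k (suc c)) (R k (suc c) ≤? i)
        where
        Goal : Set
        Goal = ∃ λ R′ → R ~ R′ × Valid R′ × Settled ρ (toℕ k) R′ × (∀ {y} → InCols k y → R′ k y ≤ i)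
        skip : (InCols k (suc c) → R k (suc c) ≤ i) → Goal
        skip low = lower-row c v settled bound paired λ ky c<y → done′ ky (m≤n⇒m<n∨m≡n c<y)
          where
          done′ : ∀ {y} → InCols k y → suc c < y ⊎ suc c ≡ y → R k y ≤ i
          done′ ky (inj₁ c<y) = done ky c<y
          done′ ky (inj₂ refl) = low ky
        move : InCols k (suc c) → R k (suc c) ≡ suc i → Goal
        move kc top =
          let v′ , step = lower-move v settled paired done kc top
              R₂ , path , rest = lower-row c v′ (Settled-update ≤-refl settled)
                (λ {y} ky → ≤-trans (shrinks y (y ℕ.≟ suc c)) (bound ky))
                (λ {y} ky → paired′ ky (y ℕ.≟ suc c))
                (λ ky c<y → done′ ky (m≤n⇒m<n∨m≡n c<y))
          in R₂ , fwd step ◅ path , rest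
          where
          R₁ : Rows
          R₁ = update R k (suc c) i
          at : R₁ k (suc c) ≡ i
          at = update-at R k (suc c) i
          off : ∀ l {y} → y ≢ suc c → R l y ≡ R₁ l y
          off l {y} y≢c = update-off R k (suc c) i l y (y≢c ∘ proj₂)
          shrinks : ∀ y → Dec (y ≡ suc c) → R₁ k y ≤ R k y
          shrinks y (yes refl) = ≤-trans (≤-reflexive at) (≤-trans (n≤1+n i) (≤-reflexive (sym top)))
          shrinks y (no y≢c)   = ≤-reflexive (sym (off k y≢c))
          done′ : ∀ {y} → InCols k y → suc c < y ⊎ suc c ≡ y → R₁ k y ≤ i
          done′ {y} ky (inj₁ c<y) = ≤-trans (shrinks y (y ℕ.≟ suc c)) (done ky c<y)
          done′ ky (inj₂ refl)    = ≤-reflexive at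
          paired′ : ∀ {y} → InCols k y → Dec (y ≡ suc c) → R₁ k y ≤ i → Has R₁ y i
          paired′ ky (yes refl) low = k , ky , at
          paired′ {y} ky (no y≢c) low =
            let l , ly , rowₗ = paired ky (≤-trans (≤-reflexive (off k y≢c)) low)
            in l , ly , trans (sym (off l y≢c)) rowₗ
        by-cases : Dec (InCols k (suc c)) → Dec (R k (suc c) ≤ i) → Goal
        by-cases (no ¬kc) _         = skip (λ kc → contradiction kc ¬kc)
        by-cases (yes _)  (yes low) = skip (λ _ → low)
        by-cases (yes kc) (no ¬low) = move kc (≤-antisym (bound kc) (≰⇒> ¬low))

      lower-label : ∀ {R} → Valid R → Settled ρ (toℕ k) R → (∀ {y} → InCols k y → R k y ≤ suc i) →
        ∃ λ R′ → R ~ R′ × Valid R′ × Settled ρ (toℕ k) R′ × (∀ {y} → InCols k y → R′ k y ≤ i)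
      lower-label {R} v settled bound = by-cases (R k (suc (start k)) ≤? i)
        where
        by-cases : Dec (R k (suc (start k)) ≤ i) →
          ∃ λ R′ → R ~ R′ × Valid R′ × Settled ρ (toℕ k) R′ × (∀ {y} → InCols k y → R′ k y ≤ i)
        by-cases (yes low) = R , ε , v , settled , λ ky → ≤-trans (descends v first (proj₁ ky) (proj₂ ky)) low
        by-cases (no ¬low) =
          let R₁ , path₁ , v₁ , settled₁ , top , full =
                fill-gaps v settled (≤-antisym (bound first) (≰⇒> ¬low)) (<-wellFounded (slack R))
              R₂ , path₂ , rest = lower-row M v₁ settled₁
                (λ ky → ≤-trans (descends v₁ first (proj₁ ky) (proj₂ ky)) (≤-reflexive top))
                -- In each column of `k`, its own cell, at or above row `ρ`, is where the stack up
                -- to row `i` starts.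
                (λ ky low → climb full (≤-<-trans z≤n (proj₁ ky)) (lb v₁ ky ≤-refl) (k , ky , refl) i low (n≤1+n i))
                (λ ky M<y → contradiction (proj₂ ky) (<⇒≱ M<y))
          in R₂ , path₁ ◅◅ path₂ , rest

    sink : ∀ t {R} → Valid R → Settled ρ (toℕ k) R → ρ + t ≤ label k → (∀ {y} → InCols k y → R k y ≤ ρ + t) →
      ∃ λ R′ → R ~ R′ × Valid R′ × Settled ρ (toℕ k) R′ × (∀ {y} → InCols k y → R′ k y ≤ ρ)
    sink zero {R} v settled room bound =
      R , ε , v , settled , λ ky → ≤-trans (bound ky) (≤-reflexive (+-identityʳ ρ))
    sink (suc t) v settled room bound =
      let R₁ , path₁ , v₁ , settled₁ , bound₁ =
            lower-label (ρ + t) (m≤m+n ρ t) (≤-trans (≤-reflexive (sym (+-suc ρ t))) room) v settled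
              (λ ky → ≤-trans (bound ky) (≤-reflexive (+-suc ρ t)))
          R₂ , path₂ , rest = sink t v₁ settled₁ (≤-trans (+-monoʳ-≤ ρ (n≤1+n t)) room) bound₁
      in R₂ , path₁ ◅◅ path₂ , rest

  -- Induction on the labels

  -- The row `ρ` is fixed before any tableau is given. The construction makes it one more than the
  -- number of nonempty labels of index below `K`.
  SettlesBelow : ℕ → Set
  SettlesBelow K = ∃ λ ρ → 1 ≤ ρ × LowerBound ρ K ×
    (∀ {R} → Valid R → ∃ λ R′ → R ~ R′ × Valid R′ × Settled ρ K R′)

  settle-next : ∀ k → SettlesBelow (toℕ k) → SettlesBelow (suc (toℕ k))
  settle-next k (ρ , 1≤ρ , lb , settle) = by-cases (InCols? k (suc (start k)))
    where
    by-cases : Dec (InCols k (suc (start k))) → SettlesBelow (suc (toℕ k))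
    by-cases (no empty) = ρ , 1≤ρ , (λ v lc k<l → lb v lc (<⇒≤ k<l)) , λ v →
      let R , path , v′ , settled = settle v
      in R , path , v′ , λ lc l≤k → extend settled lc (m≤n⇒m<n∨m≡n (s≤s⁻¹ l≤k))
      where
      extend : ∀ {R} → Settled ρ (toℕ k) R → ∀ {l c} → InCols l c → toℕ l < toℕ k ⊎ toℕ l ≡ toℕ k →
               R l c < ρ × (∀ {R′} → Valid R′ → R l c ≤ R′ l c)
      extend settled lc (inj₁ l<k) = settled lc l<k
      extend settled {l} lc (inj₂ l≡k) with refl ← Fin.toℕ-injective {i = l} {k} l≡k =
        contradiction (≤-refl , ≤-trans (proj₁ lc) (proj₂ lc)) empty
    by-cases (yes first) = suc ρ , m≤n⇒m≤1+n 1≤ρ , lb′ , λ v →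
      let R₁ , path₁ , v₁ , settled₁ = settle v
          -- The descent starts from `label k`, the general bound for the rows of `k`; the leftmost
          -- cell of `k` witnesses that `ρ` does not exceed it.
          ρ+t≡k = m+[n∸m]≡n (≤-trans (lb v₁ first ≤-refl) (bounded v₁ first))
          R₂ , path₂ , v₂ , settled₂ , bound =
            sink k ρ 1≤ρ lb first (label k ∸ ρ) v₁ settled₁ (≤-reflexive ρ+t≡k)
              (λ ky → ≤-trans (bounded v₁ ky) (≤-reflexive (sym ρ+t≡k)))
      in R₂ , path₁ ◅◅ path₂ , v₂ , λ lc l≤k → extend settled₂ bound lc (m≤n⇒m<n∨m≡n (s≤s⁻¹ l≤k))
      where
      kM : InCols k M
      kM = InCols-right first (proj₂ first) ≤-refl
      -- All nonempty labels meet in column `M`. A label above `k` lies higher than `k` there, and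
      -- at least as high in the columns to the left.
      lb′ : LowerBound (suc ρ) (suc (toℕ k))
      lb′ v lc k<l = ≤-trans (s≤s (lb v kM ≤-refl))
        (≤-trans (strict v kM (InCols-right lc (proj₂ lc) ≤-refl) k<l) (descends v lc (proj₂ lc) ≤-refl))
      extend : ∀ {R} → Settled ρ (toℕ k) R → (∀ {y} → InCols k y → R k y ≤ ρ) →
               ∀ {l c} → InCols l c → toℕ l < toℕ k ⊎ toℕ l ≡ toℕ k →
               R l c < suc ρ × (∀ {R′} → Valid R′ → R l c ≤ R′ l c)
      extend settled bound lc (inj₁ l<k) = m<n⇒m<1+n (proj₁ (settled lc l<k)) , proj₂ (settled lc l<k)
      extend settled bound {l} lc (inj₂ l≡k) with refl ← Fin.toℕ-injective {i = l} {k} l≡k =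
        s≤s (bound lc) , λ v′ → ≤-trans (bound lc) (lb v′ lc ≤-refl)

  settle-all : ∀ K → K ≤ n → SettlesBelow K
  settle-all zero    _   = 1 , ≤-refl , (λ v lc _ → positive v lc) , λ {R} v → R , ε , v , λ _ ()
  settle-all (suc K) K<n = subst (SettlesBelow ∘ suc) (Fin.toℕ-fromℕ< K<n)
    (settle-next (fromℕ< K<n) (subst SettlesBelow (sym (Fin.toℕ-fromℕ< K<n)) (settle-all K (<⇒≤ K<n))))

-- Connectedness through the minimal tableau

theorem4p5 : ∀ {n} (a : Vec ℕ n) (T T' : Filling a) →
    IsLKT a T → IsLKT a T' → Star (SymClosure (LockEdge a)) T T'
theorem4p5 {n} a T T' lkt lkt' with settle-all a n ≤-refl
... | _ , _ , _ , settle
  with settle (rowsOf-Valid a lkt) | settle (rowsOf-Valid a lkt')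
... | S , path , v , settled | S′ , path′ , v′ , settled′ =
  subst₂ (Star (SymClosure (LockEdge a))) (fill-rowsOf a T) (fill-rowsOf a T')
    (lift path ◅◅ subst (λ U → Star (SymClosure (LockEdge a)) U _) (sym same) (reverse (symmetric _) (lift path′)))
  where
  lift : ∀ {R R′} → _~_ a R R′ → Star (SymClosure (LockEdge a)) (fill a R) (fill a R′)
  lift = gmap (fill a) λ { (fwd (edge e)) → fwd e ; (bwd (edge e)) → bwd e }
  -- Each settled tableau is minimal among all valid ones, so the two are below each other in every
  -- cell.
  same : fill a S ≡ fill a S′
  same = fillBy-rowAt (fill a S′) _ λ k j → trans
    (≤-antisym (proj₂ (settled (col-InCols a k j) (Fin.toℕ<n k)) v′)
               (proj₂ (settled′ (col-InCols a k j) (Fin.toℕ<n k)) v))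
    (sym (rowAt-fill a S′ k j))
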